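{- Let $\phi:\mathbb{N}_0\to\mathbb{N}_0$ satisfy $\phi(0)=0$ and $\phi(x)\neq x$ for all $x\in\mathbb{N}$, and let $n\ge 2$. Assume the local function $\phi_n$ has no cycle. Then: (1) $M_n(\phi)$ is nilpotent of degree at most $n$. (2) For every $k\ge1$ the power $M_n(\phi)^k$ is a binary ($\{0,1\}$-valued) matrix, $\#M_n(\phi)^k\le n-k$ for $1\le k\le n$, and $M_n(\phi)^k\cap M_n(\phi)^l=0$ for all $k\ne l$, $k,l\ge1$. (3) $\widehat{M}_n(\phi)$ is invertible and $\det\widehat{M}_n(\phi)=1$. (4) $\widehat{M}_n(\phi)^{ -1}$ is a binary matrix with $\widehat{M}_n(\phi)^{ -1}=I+M_n(\phi)+\cdots+M_n(\phi)^{n-1}$ and \[ \#\widehat{M}_n(\phi)^{ -1}=n+\sum_{k=1}^{n-1}\#M_n(\phi)^k\le\binom{n+1}{2}. \]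
   Context: $\mathbb{N}=\{1,2,\dots\}$, $\mathbb{N}_0=\mathbb{N}\cup\{0\}$, $D_n=\{1,\dots,n\}$, $D_{n,0}=D_n\cup\{0\}$. The local function $\phi_n:D_{n,0}\to D_{n,0}$ is $\phi_n(x)=\phi(x)$ if $x\in D_n$ and $\phi(x)\in D_n$, and $\phi_n(x)=0$ otherwise. "$\phi_n$ has no cycle" means there are no $m\ge2$ and $x\in D_n$ with $\phi_n^m(x)=x$. For $1\le i\le n$, $\mathbf{e}_i$ is the $i$-th unit vector in $\mathbb{Z}^n$ and $\mathbf{e}_0$ is the zero vector. $M_n(\phi)$ is the $n\times n$ matrix whose $j$-th column is $\mathbf{e}_{\phi_n(j)}$, and $\widehat{M}_n(\phi)=I-M_n(\phi)$. For an $n\times n$ matrix $A$, $\#A$ is the number of nonzero entries of $A$ ($\#A^k$ means $\#(A^k)$). For $n\times n$ matrices $A,B$, $A\cap B$ denotes the number of index pairs $(i,j)$ with $A_{ij}B_{ij}\ne0$. A matrix $A$ is nilpotent of degree $k$ if $A^k=0$ and $A^{k-1}\neq 0$. -}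

module Defs where

open import Data.Nat.Base using (ℕ; zero; suc; _≤_; _∸_)
open import Data.Nat.Properties using (_<?_)
open import Data.Nat.GeneralisedArithmetic using (iterate)
open import Data.Integer.Base as ℤ using (ℤ; 0ℤ; 1ℤ; -1ℤ)
import Data.Integer.Properties as ℤₚ
open import Data.Fin.Base as Fin using (Fin; zero; suc; toℕ; fromℕ<)
import Data.Fin.Properties as Finₚ
open import Data.Fin.Permutation using (Permutation′; _⟨$⟩ʳ_; insert)
  renaming (id to idₚ)
open import Data.List.Base
  using (List; []; _∷_; length; filter; map; foldr; allFin; cartesianProduct; cartesianProductWith)
open import Data.Product.Base using (_×_; _,_; ∃; ∃-syntax)
open import Data.Sum.Base using (_⊎_)
open import Relation.Nullary using (¬_; yes; no)
open import Relation.Nullary.Decidable using (¬?; _×-dec_)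
open import Relation.Unary using (Pred; Decidable)
open import Relation.Binary.PropositionalEquality using (_≡_; _≢_)
open import Algebra.Properties.CommutativeMonoid.Sum ℤₚ.+-0-commutativeMonoid
  using () renaming (sum to ∑)
open import Algebra.Properties.CommutativeMonoid.Sum ℤₚ.*-1-commutativeMonoid
  using () renaming (sum to ∏)

-- D_{n,0} = {0,…,n} is Fin (suc n), and D_n consists of its nonzero
-- elements; j : Fin n stands for the element j + 1 of D_n, i.e. for
-- suc j : Fin (suc n).

-- In the branch φ x ≤ n the value φ x is either in D_n or equal to 0; both
-- agree with the rule "φ x if φ x ∈ D_n, and 0 otherwise".
localFun : (φ : ℕ → ℕ) (n : ℕ) → Fin (suc n) → Fin (suc n)
localFun φ n zero = zero
localFun φ n x@(suc _) with φ (toℕ x) <? suc n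
... | yes φx≤n = fromℕ< φx≤n
... | no  _    = zero

HasCycle : ∀ {n} → (Fin (suc n) → Fin (suc n)) → Set
HasCycle f = ∃[ m ] ∃[ x ] (2 ≤ m × x ≢ zero × iterate f x m ≡ x)

-- A i j is the entry in row i and column j.
Matrix : ℕ → Set
Matrix n = Fin n → Fin n → ℤ

infix  4 _≈_
infixl 6 _⊖_
infixl 7 _⊗_
infixr 8 _^ᴹ_

_≈_ : ∀ {n} → Matrix n → Matrix n → Set
A ≈ B = ∀ i j → A i j ≡ B i j

0ᴹ : ∀ {n} → Matrix n
0ᴹ _ _ = 0ℤ

Iᴹ : ∀ {n} → Matrix n
Iᴹ i j with i Finₚ.≟ j
... | yes _ = 1ℤ
... | no  _ = 0ℤ

_⊖_ : ∀ {n} → Matrix n → Matrix n → Matrix n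
(A ⊖ B) i j = A i j ℤ.- B i j

_⊗_ : ∀ {n} → Matrix n → Matrix n → Matrix n
(A ⊗ B) i j = ∑ (λ k → A i k ℤ.* B k j)

_^ᴹ_ : ∀ {n} → Matrix n → ℕ → Matrix n
A ^ᴹ zero  = Iᴹ
A ^ᴹ suc k = A ⊗ A ^ᴹ k

∑ᴹ : ∀ {n m} → (Fin m → Matrix n) → Matrix n
∑ᴹ F i j = ∑ (λ k → F k i j)

Binary : ∀ {n} → Matrix n → Set
Binary A = ∀ i j → A i j ≡ 0ℤ ⊎ A i j ≡ 1ℤ

NilpotentOfDegree : ∀ {n} → Matrix n → ℕ → Set
NilpotentOfDegree A k = 1 ≤ k × A ^ᴹ k ≈ 0ᴹ × ¬ (A ^ᴹ (k ∸ 1) ≈ 0ᴹ)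

IsInverse : ∀ {n} → Matrix n → Matrix n → Set
IsInverse A B = A ⊗ B ≈ Iᴹ × B ⊗ A ≈ Iᴹ

Invertible : ∀ {n} → Matrix n → Set
Invertible A = ∃ (IsInverse A)

countPairs : ∀ {n p} {P : Pred (Fin n × Fin n) p} → Decidable P → ℕ
countPairs {n} P? = length (filter P? (cartesianProduct (allFin n) (allFin n)))

#_ : ∀ {n} → Matrix n → ℕ
# A = countPairs λ (i , j) → ¬? (A i j ℤₚ.≟ 0ℤ)

_∩_ : ∀ {n} → Matrix n → Matrix n → ℕ
A ∩ B = countPairs λ (i , j) → ¬? (A i j ℤ.* B i j ℤₚ.≟ 0ℤ)

infix 9 #_
infix 7 _∩_

-- Every permutation of Fin n exactly once: one of Fin (suc n) is determined
-- by the image j of zero and the permutation π induced on what remains.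
permutations : ∀ n → List (Permutation′ n)
permutations zero    = idₚ ∷ []
permutations (suc n) =
  cartesianProductWith (insert zero) (allFin (suc n)) (permutations n)

inversions : ∀ {n} → Permutation′ n → ℕ
inversions π = countPairs λ (i , j) → i Finₚ.<? j ×-dec (π ⟨$⟩ʳ j) Finₚ.<? (π ⟨$⟩ʳ i)

sign : ∀ {n} → Permutation′ n → ℤ
sign π = -1ℤ ℤ.^ inversions π

-- Leibniz formula.
det : ∀ {n} → Matrix n → ℤ
det {n} A =
  foldr ℤ._+_ 0ℤ (map (λ π → sign π ℤ.* ∏ (λ i → A i (π ⟨$⟩ʳ i))) (permutations n))

-- 𝐞 x is the unit vector e_x, with e_0 the zero vector.
𝐞 : ∀ {n} → Fin (suc n) → Fin n → ℤ
𝐞 zero    _ = 0ℤ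
𝐞 (suc i) r = Iᴹ r i

M : (φ : ℕ → ℕ) (n : ℕ) → Matrix n
M φ n i j = 𝐞 (localFun φ n (suc j)) i

M̂ : (φ : ℕ → ℕ) (n : ℕ) → Matrix n
M̂ φ n = Iᴹ ⊖ M φ n

{-# OPTIONS --safe #-}

-- Column j of M^k is the unit vector of φₙᵏ(j), so everything is read off the
-- orbits of f = φₙ.  Without cycles an orbit visits a nonzero element at most
-- once; by pigeonhole fⁿ = 0, and the set of points with fᵏ ≠ 0 loses an
-- element each time k grows until it is empty, which bounds #M^k by n − k.
-- In the Leibniz formula for I − M, a permutation π with nonzero product
-- satisfies f (π i) = i at each i it moves; moved points have moved images, so
-- i = fⁿ (πⁿ i) = 0, and only the identity contributes.  The inverse follows
-- from B (I − M) = I, which says b(x) = e_x(i) + b(f x) for row i of B, read as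
-- a function b with b(0) = 0; iterating this n times gives the Neumann series.
module Submission where

open import Defs
open import Data.Nat.Base using (ℕ; zero; suc; _+_; _∸_; _≤_; _<_; z≤n; s≤s; s≤s⁻¹)
open import Data.Nat.Combinatorics using (_C_; nC1≡n; nCk+nC[k+1]≡[n+1]C[k+1])
open import Data.Nat.GeneralisedArithmetic using (iterate)
open import Data.Nat.Properties using (+-0-commutativeMonoid)
import Data.Nat.Properties as ℕₚ
open import Data.Integer.Base using (ℤ; +_; 0ℤ; 1ℤ; -1ℤ)
import Data.Integer.Base as ℤ hiding (+_)
import Data.Integer.Properties as ℤₚ
open import Data.Integer.Tactic.RingSolver using (solve-∀)
open import Data.Fin.Base as Fin using (Fin; zero; suc; toℕ; punchIn)
import Data.Fin.Properties as Finₚ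
open import Data.Fin.Permutation using (Permutation′; _⟨$⟩ʳ_; insert; insert-punchIn)
open import Function.Properties.Inverse using (↔⇒↣)
open import Data.List.Base
  using ([]; _∷_; _++_; length; filter; map; foldr; tabulate; allFin; cartesianProduct; cartesianProductWith)
open import Data.List.Properties
  using (filter-++; filter-none; length-++; map-tabulate; map-∘)
open import Data.List.Relation.Unary.All as All using (All; []; _∷_)
import Data.List.Relation.Unary.All.Properties as Allₚ
open import Data.Product.Base using (_×_; _,_; ∃-syntax)
open import Data.Sum.Base using (_⊎_; inj₁; inj₂)
open import Function.Base using (_∘_)
open import Function.Bundles using (module Injection)
open import Relation.Nullary using (¬_; yes; no; contradiction; decidable-stable)
open import Relation.Nullary.Decidable using (¬?; _×-dec_)
open import Relation.Unary using (Pred; Decidable)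
open import Relation.Binary.Definitions using (tri<; tri≈; tri>)
open import Relation.Binary.PropositionalEquality
open import Algebra.Properties.CommutativeMonoid.Sum +-0-commutativeMonoid using (sum)
  renaming (sum-cong-≗ to sumℕ-cong; sum-replicate-zero to sumℕ-zero)
open import Algebra.Properties.CommutativeMonoid.Sum ℤₚ.*-1-commutativeMonoid
  using () renaming (sum to ∏)
open import Algebra.Properties.Semiring.Sum ℤₚ.+-*-semiring
  using (sum-cong-≗; sum-remove; sum-replicate-zero; ∑-comm; *-distribˡ-sum)
  renaming (sum to ∑)
open ≡-Reasoning

-- Finite sums and products.

∑-zero : ∀ {n} (t : Fin n → ℤ) → (∀ i → t i ≡ 0ℤ) → ∑ t ≡ 0ℤ
∑-zero {n} t t≡0 = trans (sum-cong-≗ t≡0) (sum-replicate-zero n)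

∑-single : ∀ {n} (t : Fin n → ℤ) i → (∀ j → j ≢ i → t j ≡ 0ℤ) → ∑ t ≡ t i
∑-single {suc _} t i t≡0 = begin
  ∑ t                            ≡⟨ sum-remove {i = i} t ⟩
  t i ℤ.+ ∑ (t ∘ punchIn i)      ≡⟨ cong (ℤ._+_ (t i)) (∑-zero _ λ j → t≡0 _ (Finₚ.punchInᵢ≢i i j)) ⟩
  t i ℤ.+ 0ℤ                     ≡⟨ ℤₚ.+-identityʳ (t i) ⟩
  t i                            ∎

∑-distrib-− : ∀ {n} (s t : Fin n → ℤ) → ∑ (λ i → s i ℤ.- t i) ≡ ∑ s ℤ.- ∑ t
∑-distrib-− {zero}  s t = refl
∑-distrib-− {suc n} s t =
  trans (cong (ℤ._+_ (s zero ℤ.- t zero)) (∑-distrib-− (s ∘ suc) (t ∘ suc)))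
        (interchange (s zero) (t zero) (∑ (s ∘ suc)) (∑ (t ∘ suc)))
  where
  interchange : ∀ a b c d → (a ℤ.- b) ℤ.+ (c ℤ.- d) ≡ (a ℤ.+ c) ℤ.- (b ℤ.+ d)
  interchange = solve-∀

∑-telescope : ∀ n (t : ℕ → ℤ) → ∑ {n} (λ k → t (toℕ k) ℤ.- t (suc (toℕ k))) ≡ t 0 ℤ.- t n
∑-telescope zero    t = sym (ℤₚ.+-inverseʳ (t 0))
∑-telescope (suc n) t =
  trans (cong (ℤ._+_ (t 0 ℤ.- t 1)) (∑-telescope n (t ∘ suc))) (cancel (t 0) (t 1) (t (suc n)))
  where
  cancel : ∀ a b c → (a ℤ.- b) ℤ.+ (b ℤ.- c) ≡ a ℤ.- c
  cancel = solve-∀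

∑-binary : ∀ {n} (t : Fin n → ℤ) → (∀ k → t k ≡ 0ℤ ⊎ t k ≡ 1ℤ) →
           (∀ k l → t k ≢ 0ℤ → t l ≢ 0ℤ → k ≡ l) → ∑ t ≡ 0ℤ ⊎ ∑ t ≡ 1ℤ
∑-binary t binary unique with Finₚ.any? (λ k → ¬? (t k ℤₚ.≟ 0ℤ))
... | yes (k , tk≢0) = subst (λ z → z ≡ 0ℤ ⊎ z ≡ 1ℤ)
  (sym (∑-single t k λ l l≢k → decidable-stable (t l ℤₚ.≟ 0ℤ) λ tl≢0 → l≢k (unique l k tl≢0 tk≢0)))
  (binary k)
... | no  none = inj₁ (∑-zero t λ k → decidable-stable (t k ℤₚ.≟ 0ℤ) λ tk≢0 → none (k , tk≢0))

∏-zero : ∀ {n} (t : Fin n → ℤ) i → t i ≡ 0ℤ → ∏ t ≡ 0ℤ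
∏-zero t zero    ti≡0 = cong (ℤ._* ∏ (t ∘ suc)) ti≡0
∏-zero t (suc i) ti≡0 = trans (cong (t zero ℤ.*_) (∏-zero (t ∘ suc) i ti≡0)) (ℤₚ.*-zeroʳ (t zero))

∏-one : ∀ {n} (t : Fin n → ℤ) → (∀ i → t i ≡ 1ℤ) → ∏ t ≡ 1ℤ
∏-one {zero}  t t≡1 = refl
∏-one {suc n} t t≡1 = cong₂ ℤ._*_ (t≡1 zero) (∏-one (t ∘ suc) (t≡1 ∘ suc))

pos-sum : ∀ {n} (t : Fin n → ℕ) → + sum t ≡ ∑ (λ i → + t i)
pos-sum {zero}  t = refl
pos-sum {suc n} t = cong (ℤ._+_ (+ t zero)) (pos-sum (t ∘ suc))

sum-one : ∀ n → sum {n} (λ _ → 1) ≡ n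
sum-one zero    = refl
sum-one (suc n) = cong suc (sum-one n)

sum-mono-≤ : ∀ {n} (s t : Fin n → ℕ) → (∀ i → s i ≤ t i) → sum s ≤ sum t
sum-mono-≤ {zero}  s t s≤t = z≤n
sum-mono-≤ {suc n} s t s≤t = ℕₚ.+-mono-≤ (s≤t zero) (sum-mono-≤ (s ∘ suc) (t ∘ suc) (s≤t ∘ suc))

sum-mono-< : ∀ {n} (s t : Fin n → ℕ) → (∀ i → s i ≤ t i) → ∀ i → s i < t i → sum s < sum t
sum-mono-< s t s≤t zero    s<t = ℕₚ.+-mono-<-≤ s<t (sum-mono-≤ (s ∘ suc) (t ∘ suc) (s≤t ∘ suc))
sum-mono-< s t s≤t (suc i) s<t = ℕₚ.+-mono-≤-< (s≤t zero) (sum-mono-< (s ∘ suc) (t ∘ suc) (s≤t ∘ suc) i s<t)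

-- In the inductive step the term at `k = 0` is `suc n C 1` and the remaining terms form the sum for
-- `n`, so Pascal's rule applies.
sum-[n∸k]≡[n+1]C2 : ∀ n → sum {n} (λ k → n ∸ toℕ k) ≡ suc n C 2
sum-[n∸k]≡[n+1]C2 zero    = refl
sum-[n∸k]≡[n+1]C2 (suc n) =
  trans (cong₂ _+_ (sym (nC1≡n (suc n))) (sum-[n∸k]≡[n+1]C2 n)) (nCk+nC[k+1]≡[n+1]C[k+1] (suc n) 1)

-- Counts of index pairs as integer sums.

module _ {a p} {A : Set a} {P : Pred A p} (P? : Decidable P) (w : A → ℤ)
         (w≡1 : ∀ {x} → P x → w x ≡ 1ℤ) (w≡0 : ∀ {x} → ¬ P x → w x ≡ 0ℤ) where

  length-filter-tabulate : ∀ {n} (g : Fin n → A) → + length (filter P? (tabulate g)) ≡ ∑ (w ∘ g)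
  length-filter-tabulate {zero}  g = refl
  length-filter-tabulate {suc n} g with P? (g zero)
  ... | yes p = cong₂ ℤ._+_ (sym (w≡1 p)) (length-filter-tabulate (g ∘ suc))
  ... | no ¬p = trans (length-filter-tabulate (g ∘ suc))
                      (sym (trans (cong (ℤ._+ ∑ (w ∘ g ∘ suc)) (w≡0 ¬p)) (ℤₚ.+-identityˡ _)))

module _ {n p} {P : Pred (Fin n × Fin n) p} (P? : Decidable P) where

  countPairs-∑ : (w : Fin n × Fin n → ℤ) →
                 (∀ {x} → P x → w x ≡ 1ℤ) → (∀ {x} → ¬ P x → w x ≡ 0ℤ) →
                 + countPairs P? ≡ ∑ (λ i → ∑ (λ j → w (i , j)))
  countPairs-∑ w w≡1 w≡0 = rows (λ i → i)
    where
    js = allFin n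
    -- The list of rows is generalised to `tabulate g`, a form that survives removal of the first
    -- row; the columns stay fixed.
    rows : ∀ {m} (g : Fin m → Fin n) →
           + length (filter P? (cartesianProduct (tabulate g) js)) ≡ ∑ (λ i → ∑ (λ j → w (g i , j)))
    rows {zero}  g = refl
    rows {suc m} g = begin
      + length (filter P? (row ++ rest))
        ≡⟨ cong (+_ ∘ length) (filter-++ P? row rest) ⟩
      + length (filter P? row ++ filter P? rest)
        ≡⟨ cong +_ (length-++ (filter P? row)) ⟩
      + length (filter P? row) ℤ.+ + length (filter P? rest)
        ≡⟨ cong₂ ℤ._+_
             (trans (cong (+_ ∘ length ∘ filter P?) (map-tabulate (λ j → j) (g zero ,_)))
                    (length-filter-tabulate P? w w≡1 w≡0 (g zero ,_)))
             (rows (g ∘ suc)) ⟩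
      ∑ (λ i → ∑ (λ j → w (g i , j))) ∎
      where
      row = map (g zero ,_) js
      rest = cartesianProduct (tabulate (g ∘ suc)) js

  countPairs-none : (∀ x → ¬ P x) → countPairs P? ≡ 0
  countPairs-none ¬P = cong length (filter-none P? (All.universal ¬P (cartesianProduct (allFin n) (allFin n))))

-- A nonzero entry equals its own weight 1. Counting thus becomes summation in ℤ, where the order of
-- summation can be exchanged.
#-binary : ∀ {n} {A : Matrix n} → Binary A → + # A ≡ ∑ (λ i → ∑ (A i))
#-binary {A = A} binary = countPairs-∑ _ (λ (i , j) → A i j)
  (λ {(i , j)} A≢0 → one (binary i j) A≢0)
  (λ {(i , j)} → decidable-stable (A i j ℤₚ.≟ 0ℤ))
  where
  one : ∀ {z} → z ≡ 0ℤ ⊎ z ≡ 1ℤ → z ≢ 0ℤ → z ≡ 1ℤ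
  one (inj₁ z≡0) z≢0 = contradiction z≡0 z≢0
  one (inj₂ z≡1) z≢0 = z≡1

-- Leibniz sums to which only the identity contributes.

∑-permutations : ∀ n (g : Permutation′ n → ℤ) →
                 (∀ π → (∀ i → π ⟨$⟩ʳ i ≡ i) → g π ≡ 1ℤ) →
                 (∀ π i → π ⟨$⟩ʳ i ≢ i → g π ≡ 0ℤ) →
                 foldr ℤ._+_ 0ℤ (map g (permutations n)) ≡ 1ℤ
∑-permutations zero    g g≡1 g≡0 = trans (ℤₚ.+-identityʳ _) (g≡1 _ λ ())
-- The list begins with the permutations that fix zero, which are handled by induction. The rest,
-- `moving`, send zero to a successor, so `g` vanishes on them.
∑-permutations (suc n) g g≡1 g≡0 = begin
  Σg (map (insert zero zero) (permutations n) ++ moving)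
    ≡⟨ Σ-++ (map (insert zero zero) (permutations n)) ⟩
  Σg (map (insert zero zero) (permutations n)) ℤ.+ Σg moving
    ≡⟨ cong₂ ℤ._+_ (cong (foldr ℤ._+_ 0ℤ) (sym (map-∘ (permutations n)))) (Σ-zero moving≡0) ⟩
  foldr ℤ._+_ 0ℤ (map (g ∘ insert zero zero) (permutations n)) ℤ.+ 0ℤ
    ≡⟨ ℤₚ.+-identityʳ _ ⟩
  foldr ℤ._+_ 0ℤ (map (g ∘ insert zero zero) (permutations n))
    ≡⟨ ∑-permutations n (g ∘ insert zero zero)
         (λ π fix → g≡1 _ λ { zero → refl ; (suc i) → trans (insert-punchIn zero zero π i) (cong suc (fix i)) })
         (λ π i move → g≡0 _ (suc i) λ eq →
           move (Finₚ.suc-injective (trans (sym (insert-punchIn zero zero π i)) eq))) ⟩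
  1ℤ ∎
  where
  Σg = λ πs → foldr ℤ._+_ 0ℤ (map g πs)
  moving = cartesianProductWith (insert zero) (tabulate suc) (permutations n)

  Σ-++ : ∀ πs {ρs} → Σg (πs ++ ρs) ≡ Σg πs ℤ.+ Σg ρs
  Σ-++ []       = sym (ℤₚ.+-identityˡ _)
  Σ-++ (π ∷ πs) = trans (cong (ℤ._+_ (g π)) (Σ-++ πs)) (sym (ℤₚ.+-assoc (g π) (Σg πs) _))

  Σ-zero : ∀ {πs} → All (λ π → g π ≡ 0ℤ) πs → Σg πs ≡ 0ℤ
  Σ-zero []           = refl
  Σ-zero (eq ∷ rest) = cong₂ ℤ._+_ eq (Σ-zero rest)

  moving≡0 : All (λ π → g π ≡ 0ℤ) moving
  moving≡0 = Allₚ.cartesianProductWith⁺ (setoid _) (setoid _) (insert zero) (tabulate suc) (permutations n)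
    λ j∈ _ → g≡0 _ zero (All.lookup (Allₚ.tabulate⁺ {P = _≢ zero} (λ _ ())) j∈)

sign-id : ∀ {n} (π : Permutation′ n) → (∀ i → π ⟨$⟩ʳ i ≡ i) → sign π ≡ 1ℤ
sign-id π fix = cong (-1ℤ ℤ.^_) no-inversions
  where
  no-inversions : inversions π ≡ 0
  no-inversions = countPairs-none
    (λ (i , j) → i Finₚ.<? j ×-dec (π ⟨$⟩ʳ j) Finₚ.<? (π ⟨$⟩ʳ i)) λ (i , j) (i<j , πj<πi) →
    Finₚ.<-asym i<j (subst₂ Fin._<_ (fix j) (fix i) πj<πi)

det-identity-only : ∀ {n} (A : Matrix n) → (∀ i → A i i ≡ 1ℤ) →
                    (∀ (π : Permutation′ n) i → π ⟨$⟩ʳ i ≢ i → ∃[ k ] A k (π ⟨$⟩ʳ k) ≡ 0ℤ) →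
                    det A ≡ 1ℤ
det-identity-only {n} A diagonal vanish = ∑-permutations n _
  (λ π fix → cong₂ ℤ._*_ (sign-id π fix)
    (∏-one _ λ i → trans (cong (A i) (fix i)) (diagonal i)))
  (λ π i move → let k , eq = vanish π i move in
    trans (cong (sign π ℤ.*_) (∏-zero _ k eq)) (ℤₚ.*-zeroʳ (sign π)))

-- Unit vectors.

Iᴹ-diagonal : ∀ {n} (i : Fin n) → Iᴹ i i ≡ 1ℤ
Iᴹ-diagonal i with i Finₚ.≟ i
... | yes _   = refl
... | no  i≢i = contradiction refl i≢i

Iᴹ-off-diagonal : ∀ {n} {i j : Fin n} → i ≢ j → Iᴹ i j ≡ 0ℤ
Iᴹ-off-diagonal {i = i} {j} i≢j with i Finₚ.≟ j
... | yes i≡j = contradiction i≡j i≢j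
... | no  _   = refl

𝐞-binary : ∀ {n} (x : Fin (suc n)) i → 𝐞 x i ≡ 0ℤ ⊎ 𝐞 x i ≡ 1ℤ
𝐞-binary zero    i = inj₁ refl
𝐞-binary (suc j) i with i Finₚ.≟ j
... | yes _ = inj₂ refl
... | no  _ = inj₁ refl

𝐞-support : ∀ {n} (x : Fin (suc n)) i → 𝐞 x i ≢ 0ℤ → x ≡ suc i
𝐞-support zero    i 𝐞≢0 = contradiction refl 𝐞≢0
𝐞-support (suc j) i 𝐞≢0 with i Finₚ.≟ j
... | yes i≡j = cong suc (sym i≡j)
... | no  _   = contradiction refl 𝐞≢0

-- A row becomes a function on all of D_{n,0} with value 0 at 0, matching the convention that
-- `𝐞 zero` is the zero vector.
extend : ∀ {n} → (Fin n → ℤ) → Fin (suc n) → ℤ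
extend v zero    = 0ℤ
extend v (suc i) = v i

∑-𝐞 : ∀ {n} (v : Fin n → ℤ) x → ∑ (λ r → v r ℤ.* 𝐞 x r) ≡ extend v x
∑-𝐞 v zero    = ∑-zero _ (ℤₚ.*-zeroʳ ∘ v)
∑-𝐞 v (suc s) = begin
  ∑ (λ r → v r ℤ.* Iᴹ r s)
    ≡⟨ ∑-single _ s (λ r r≢s → trans (cong (v r ℤ.*_) (Iᴹ-off-diagonal r≢s)) (ℤₚ.*-zeroʳ (v r))) ⟩
  v s ℤ.* Iᴹ s s
    ≡⟨ cong (v s ℤ.*_) (Iᴹ-diagonal s) ⟩
  v s ℤ.* 1ℤ
    ≡⟨ ℤₚ.*-identityʳ (v s) ⟩
  v s ∎

indicator : ∀ {n} → Fin (suc n) → ℕ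
indicator zero    = 0
indicator (suc _) = 1

∑-𝐞-indicator : ∀ {n} (x : Fin (suc n)) → ∑ (𝐞 x) ≡ + indicator x
∑-𝐞-indicator {n} zero = sum-replicate-zero n
∑-𝐞-indicator (suc s) = trans (∑-single _ s λ r → Iᴹ-off-diagonal) (Iᴹ-diagonal s)

-- Iterates and threshold indices.

iterate-suc : ∀ {a} {A : Set a} (f : A → A) x k → iterate f (f x) k ≡ f (iterate f x k)
iterate-suc f x zero    = refl
iterate-suc f x (suc k) = iterate-suc f (f x) k

iterate-+ : ∀ {a} {A : Set a} (f : A → A) x k l → iterate f x (k + l) ≡ iterate f (iterate f x k) l
iterate-+ f x zero    l = refl
iterate-+ f x (suc k) l = iterate-+ f (f x) k l

-- Descends from `n` while the predecessor still satisfies `P`; the descent must stop because `P`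
-- fails at 0.
∃-transition : ∀ {p} {P : Pred ℕ p} → Decidable P → ∀ n → ¬ P 0 → P n →
               ∃[ d ] (d ≤ n × 1 ≤ d × P d × ¬ P (d ∸ 1))
∃-transition P? zero    ¬P0 Pn = contradiction Pn ¬P0
∃-transition P? (suc n) ¬P0 Pn with P? n
... | yes P[n] = let d , d≤n , rest = ∃-transition P? n ¬P0 P[n] in d , ℕₚ.m≤n⇒m≤1+n d≤n , rest
... | no ¬P[n] = suc n , ℕₚ.≤-refl , s≤s z≤n , Pn , ¬P[n]

-- Abstracts from `φ`: `M φ n` is `matrixOf (localFun φ n)` by definition.
matrixOf : ∀ {n} → (Fin (suc n) → Fin (suc n)) → Matrix n
matrixOf f i j = 𝐞 (f (suc j)) i

-- Orbits of a map without cycles or nonzero fixed points.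

module _ {n} (f : Fin (suc n) → Fin (suc n)) (f0≡0 : f zero ≡ zero)
         (acyclic : ∀ m {x} → x ≢ zero → iterate f x (suc m) ≢ x) where

  iterate-zero : ∀ k → iterate f zero k ≡ zero
  iterate-zero zero    = refl
  iterate-zero (suc k) = trans (cong (λ x → iterate f x k) f0≡0) (iterate-zero k)

  -- With `l = suc k + t`, the nonzero point reached at time `k` would return to itself after
  -- `suc t` steps.
  no-return : ∀ {k l} x → iterate f x k ≢ zero → iterate f x k ≡ iterate f x l → ¬ k < l
  no-return {k} x y≢0 eq k<l with t , refl ← ℕₚ.m≤n⇒∃[o]m+o≡n k<l =
    acyclic t y≢0 (sym (begin
      iterate f x k                   ≡⟨ eq ⟩
      iterate f x (suc k + t)         ≡⟨ cong (iterate f x) (ℕₚ.+-suc k t) ⟨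
      iterate f x (k + suc t)         ≡⟨ iterate-+ f x k (suc t) ⟩
      iterate f (iterate f x k) (suc t) ∎))

  visit-once : ∀ {k l} x → iterate f x k ≢ zero → iterate f x k ≡ iterate f x l → k ≡ l
  visit-once {k} {l} x y≢0 eq with ℕₚ.<-cmp k l
  ... | tri< k<l _ _ = contradiction k<l (no-return x y≢0 eq)
  ... | tri≈ _ k≡l _ = k≡l
  ... | tri> _ _ l<k = contradiction l<k (no-return x (y≢0 ∘ trans eq) (sym eq))

  iterate-n≡0 : ∀ x → iterate f x n ≡ zero
  iterate-n≡0 x
    -- The times 0 to n + 1 outnumber the n + 1 points, so some value repeats, and it can only be 0.
    -- The earlier time `i` is at most `n`, and from then on the orbit stays at 0.
    with i , j , i<j , eq ← Finₚ.pigeonhole (ℕₚ.n<1+n (suc n)) (iterate f x ∘ toℕ)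
    with iterate f x (toℕ i) Finₚ.≟ zero
  ... | no  y≢0 = contradiction i<j (no-return x y≢0 eq)
  ... | yes y≡0
    with t , i+t≡n ← ℕₚ.m≤n⇒∃[o]m+o≡n (s≤s⁻¹ (ℕₚ.≤-trans i<j (s≤s⁻¹ (Finₚ.toℕ<n j)))) = begin
      iterate f x n                     ≡⟨ cong (iterate f x) i+t≡n ⟨
      iterate f x (toℕ i + t)           ≡⟨ iterate-+ f x (toℕ i) t ⟩
      iterate f (iterate f x (toℕ i)) t ≡⟨ cong (λ y → iterate f y t) y≡0 ⟩
      iterate f zero t                  ≡⟨ iterate-zero t ⟩
      zero                              ∎

  -- Powers of the matrix.

  extend-matrixOf : ∀ i x → extend (matrixOf f i) x ≡ 𝐞 (f x) i
  extend-matrixOf i zero    = cong (λ y → 𝐞 y i) (sym f0≡0)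
  extend-matrixOf i (suc j) = refl

  -- Multiplication by `matrixOf f` sends `𝐞 x` to `𝐞 (f x)`, also at `x = zero` because `f` fixes
  -- zero.
  power-entry : ∀ k i j → (matrixOf f ^ᴹ k) i j ≡ 𝐞 (iterate f (suc j) k) i
  power-entry zero    i j = refl
  power-entry (suc k) i j = begin
    ∑ (λ r → matrixOf f i r ℤ.* (matrixOf f ^ᴹ k) r j)
      ≡⟨ sum-cong-≗ (λ r → cong (matrixOf f i r ℤ.*_) (power-entry k r j)) ⟩
    ∑ (λ r → matrixOf f i r ℤ.* 𝐞 (iterate f (suc j) k) r)
      ≡⟨ ∑-𝐞 (matrixOf f i) (iterate f (suc j) k) ⟩
    extend (matrixOf f i) (iterate f (suc j) k)
      ≡⟨ extend-matrixOf i (iterate f (suc j) k) ⟩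
    𝐞 (f (iterate f (suc j) k)) i
      ≡⟨ cong (λ y → 𝐞 y i) (iterate-suc f (suc j) k) ⟨
    𝐞 (iterate f (suc j) (suc k)) i ∎

  power-binary : ∀ k → Binary (matrixOf f ^ᴹ k)
  power-binary k i j rewrite power-entry k i j = 𝐞-binary (iterate f (suc j) k) i

  power-support : ∀ k i j → (matrixOf f ^ᴹ k) i j ≢ 0ℤ → iterate f (suc j) k ≡ suc i
  power-support k i j ≢0 = 𝐞-support _ i (≢0 ∘ trans (power-entry k i j))

  -- A common nonzero position (i, j) means that the orbit of `suc j` is at `suc i` at both times.
  powers-disjoint : ∀ k l i j → (matrixOf f ^ᴹ k) i j ≢ 0ℤ → (matrixOf f ^ᴹ l) i j ≢ 0ℤ → k ≡ l
  powers-disjoint k l i j k≢0 l≢0 with eq ← power-support k i j k≢0 =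
    visit-once (suc j) (λ ≡0 → contradiction (trans (sym eq) ≡0) λ ()) (trans eq (sym (power-support l i j l≢0)))

  power-∩ : ∀ k l → k ≢ l → (matrixOf f ^ᴹ k) ∩ (matrixOf f ^ᴹ l) ≡ 0
  power-∩ k l k≢l = countPairs-none _ λ (i , j) ≢0 →
    k≢l (powers-disjoint k l i j
      (λ eq → ≢0 (cong (ℤ._* (matrixOf f ^ᴹ l) i j) eq))
      (λ eq → ≢0 (trans (cong ((matrixOf f ^ᴹ k) i j ℤ.*_) eq) (ℤₚ.*-zeroʳ ((matrixOf f ^ᴹ k) i j)))))

  -- The number of nonzero entries of a power.

  survivors : ℕ → ℕ
  survivors k = sum {n} (λ j → indicator (iterate f (suc j) k))

  -- Column `j` is a unit vector or zero, so summing by columns counts the starting points whose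
  -- orbit has not reached 0 by time `k`.
  #-power : ∀ k → # (matrixOf f ^ᴹ k) ≡ survivors k
  #-power k = ℤₚ.+-injective (begin
    + # (matrixOf f ^ᴹ k)
      ≡⟨ #-binary (power-binary k) ⟩
    ∑ (λ i → ∑ (λ j → (matrixOf f ^ᴹ k) i j))
      ≡⟨ ∑-comm (matrixOf f ^ᴹ k) ⟩
    ∑ (λ j → ∑ (λ i → (matrixOf f ^ᴹ k) i j))
      ≡⟨ sum-cong-≗ (λ j → trans (sum-cong-≗ (λ i → power-entry k i j))
                                 (∑-𝐞-indicator (iterate f (suc j) k))) ⟩
    ∑ (λ j → + indicator (iterate f (suc j) k))
      ≡⟨ pos-sum (λ j → indicator (iterate f (suc j) k)) ⟨
    + survivors k ∎)

  -- Walk along the orbit of `x` until the iterate of order `suc k` vanishes. The walk takes fewer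
  -- than `m` steps, since at 0 the iterate of order `k` would vanish too.
  last-survivor : ∀ k m x → iterate f x m ≡ zero → iterate f x k ≢ zero →
                  ∃[ y ] (iterate f y k ≢ zero × iterate f y (suc k) ≡ zero)
  last-survivor k zero    x x≡0 ≢0 = contradiction (trans (cong (λ y → iterate f y k) x≡0) (iterate-zero k)) ≢0
  last-survivor k (suc m) x ≡0 ≢0 with iterate f x (suc k) Finₚ.≟ zero
  ... | yes ≡0′ = x , ≢0 , ≡0′
  ... | no  ≢0′ = last-survivor k m (f x) ≡0 ≢0′

  indicator-decreasing : ∀ k x → indicator (iterate f x (suc k)) ≤ indicator (iterate f x k)
  indicator-decreasing k x rewrite iterate-suc f x k = step (iterate f x k)
    where
    step : ∀ y → indicator (f y) ≤ indicator y
    step zero rewrite f0≡0 = z≤n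
    step (suc y) with f (suc y)
    ... | zero  = z≤n
    ... | suc _ = s≤s z≤n

  survivors≤n∸k : ∀ k → survivors k ≤ n ∸ k
  survivors≤n∸k zero    = ℕₚ.≤-reflexive (sum-one n)
  survivors≤n∸k (suc k) with Finₚ.all? (λ j → iterate f (suc j) (suc k) Finₚ.≟ zero)
  ... | yes all≡0 = ℕₚ.≤-trans (ℕₚ.≤-reflexive empty) z≤n
    where
    empty : survivors (suc k) ≡ 0
    empty = trans (sumℕ-cong (cong indicator ∘ all≡0)) (sumℕ-zero n)
  ... | no  ¬all≡0
    with j , ≢0 ← Finₚ.¬∀⟶∃¬ n _ (λ j → iterate f (suc j) (suc k) Finₚ.≟ zero) ¬all≡0
    with last-survivor k n (suc j) (iterate-n≡0 (suc j))
           (λ ≡0 → ≢0 (trans (iterate-suc f (suc j) k) (trans (cong f ≡0) f0≡0)))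
  ... | zero  , ≢0′ , _    = contradiction (iterate-zero k) ≢0′
  -- The point `suc y` is lost exactly at time `suc k`, so the count drops strictly; taking
  -- predecessors turns the bound `n ∸ k` into `n ∸ suc k`.
  ... | suc y , ≢0′ , dies = subst (survivors (suc k) ≤_) (ℕₚ.pred[m∸n]≡m∸[1+n] n k)
    (ℕₚ.pred-mono-≤ (ℕₚ.≤-trans
      (sum-mono-< _ _ (indicator-decreasing k ∘ suc) y
        (subst (_< indicator (iterate f (suc y) k)) (sym (cong indicator dies)) (positive ≢0′)))
      (survivors≤n∸k k)))
    where
    positive : ∀ {x} → x ≢ zero → 0 < indicator {n} x
    positive {zero}  x≢0 = contradiction refl x≢0
    positive {suc _} x≢0 = s≤s z≤n

  #-power≤ : ∀ k → # (matrixOf f ^ᴹ k) ≤ n ∸ k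
  #-power≤ k = subst (_≤ n ∸ k) (sym (#-power k)) (survivors≤n∸k k)

  -- Nilpotency.

  power-n≡0 : matrixOf f ^ᴹ n ≈ 0ᴹ
  power-n≡0 i j = trans (power-entry n i j) (cong (λ x → 𝐞 x i) (iterate-n≡0 (suc j)))

  -- The power of exponent 0 is the identity, nonzero as `1 ≤ n`, and that of exponent `n` is zero;
  -- the degree is found in between.
  nilpotent : 1 ≤ n → ∃[ d ] (d ≤ n × NilpotentOfDegree (matrixOf f) d)
  nilpotent 1≤n = ∃-transition (λ k → Finₚ.all? λ i → Finₚ.all? λ j → (matrixOf f ^ᴹ k) i j ℤₚ.≟ 0ℤ)
                               n (I≉0 1≤n) power-n≡0
    where
    I≉0 : ∀ {m} → 1 ≤ m → ¬ (Iᴹ {m} ≈ 0ᴹ)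
    I≉0 (s≤s _) I≈0 with () ← I≈0 zero zero

  -- The determinant of I - M.

  I⊖M : Matrix n
  I⊖M = Iᴹ ⊖ matrixOf f

  -- A nonzero diagonal entry of `matrixOf f` would give a fixed point of `f` other than zero.
  I⊖M-diagonal : ∀ i → I⊖M i i ≡ 1ℤ
  I⊖M-diagonal i = cong₂ ℤ._-_ (Iᴹ-diagonal i)
    (decidable-stable (𝐞 (f (suc i)) i ℤₚ.≟ 0ℤ) λ ≢0 → acyclic 0 (λ ()) (𝐞-support (f (suc i)) i ≢0))

  I⊖M-support : ∀ {i j} → i ≢ j → I⊖M i j ≢ 0ℤ → f (suc j) ≡ suc i
  I⊖M-support {i} {j} i≢j ≢0 = 𝐞-support (f (suc j)) i λ ≡0 → ≢0 (cong₂ ℤ._-_ (Iᴹ-off-diagonal i≢j) ≡0)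

  moving-permutation-vanishes : ∀ (π : Permutation′ n) i → π ⟨$⟩ʳ i ≢ i → ∃[ k ] I⊖M k (π ⟨$⟩ʳ k) ≡ 0ℤ
  moving-permutation-vanishes π i πi≢i with Finₚ.any? (λ k → I⊖M k (π ⟨$⟩ʳ k) ℤₚ.≟ 0ℤ)
  ... | yes found = found
  ... | no  none  = contradiction (trans (sym (iterate-n≡0 _)) (backtrack n i πi≢i)) λ ()
    where
    backtrack : ∀ k i → π ⟨$⟩ʳ i ≢ i → iterate f (suc (iterate (π ⟨$⟩ʳ_) i k)) k ≡ suc i
    backtrack zero    i _    = refl
    backtrack (suc k) i πi≢i = begin
      iterate f (suc (iterate (π ⟨$⟩ʳ_) (π ⟨$⟩ʳ i) k)) (suc k)
        ≡⟨ iterate-suc f _ k ⟩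
      f (iterate f (suc (iterate (π ⟨$⟩ʳ_) (π ⟨$⟩ʳ i) k)) k)
        -- Injectivity of `π` shows that the image of a moved point is moved again, so the induction
        -- hypothesis applies to it.
        ≡⟨ cong f (backtrack k (π ⟨$⟩ʳ i) (πi≢i ∘ Injection.injective (↔⇒↣ π))) ⟩
      f (suc (π ⟨$⟩ʳ i))
        ≡⟨ I⊖M-support (πi≢i ∘ sym) (λ ≡0 → none (i , ≡0)) ⟩
      suc i ∎

  det-I⊖M : det I⊖M ≡ 1ℤ
  det-I⊖M = det-identity-only I⊖M I⊖M-diagonal moving-permutation-vanishes

  -- The Neumann series as the two-sided inverse.

  neumann : Matrix n
  neumann = ∑ᴹ (λ (k : Fin n) → matrixOf f ^ᴹ toℕ k)

  -- The number of visits of the orbit of `x` to `suc i` before time `m`. The length `m` is free so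
  -- that the recurrence for a left inverse can be unfolded by induction on it.
  orbitSum : ℕ → Fin (suc n) → Fin n → ℤ
  orbitSum m x i = ∑ {m} (λ k → 𝐞 (iterate f x (toℕ k)) i)

  neumann-entry : ∀ i j → neumann i j ≡ orbitSum n (suc j) i
  neumann-entry i j = sum-cong-≗ λ (k : Fin n) → power-entry (toℕ k) i j

  extend-neumann : ∀ i x → extend (neumann i) x ≡ orbitSum n x i
  extend-neumann i zero    = sym (∑-zero _ λ (k : Fin n) → cong (λ x → 𝐞 x i) (iterate-zero (toℕ k)))
  extend-neumann i (suc j) = neumann-entry i j

  orbitSum-telescope : ∀ i x → ∑ {n} (λ k → 𝐞 (iterate f x (toℕ k)) i ℤ.- 𝐞 (iterate f x (suc (toℕ k))) i) ≡ 𝐞 x i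
  orbitSum-telescope i x = begin
    ∑ {n} (λ k → 𝐞 (iterate f x (toℕ k)) i ℤ.- 𝐞 (iterate f x (suc (toℕ k))) i)
      ≡⟨ ∑-telescope n (λ k → 𝐞 (iterate f x k) i) ⟩
    𝐞 x i ℤ.- 𝐞 (iterate f x n) i
      ≡⟨ cong (λ y → 𝐞 x i ℤ.- 𝐞 y i) (iterate-n≡0 x) ⟩
    𝐞 x i ℤ.- 0ℤ
      ≡⟨ ℤₚ.+-identityʳ (𝐞 x i) ⟩
    𝐞 x i ∎

  -- Column `j` of I - M is `𝐞 (suc j)` minus `𝐞 (f (suc j))`, and multiplying by a unit vector
  -- selects an entry of the row.
  ⊗-I⊖M : ∀ (B : Matrix n) i j → (B ⊗ I⊖M) i j ≡ B i j ℤ.- extend (B i) (f (suc j))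
  ⊗-I⊖M B i j = begin
    ∑ (λ r → B i r ℤ.* (Iᴹ r j ℤ.- 𝐞 (f (suc j)) r))
      ≡⟨ sum-cong-≗ (λ r → distrib (B i r) (Iᴹ r j) (𝐞 (f (suc j)) r)) ⟩
    ∑ (λ r → B i r ℤ.* Iᴹ r j ℤ.- B i r ℤ.* 𝐞 (f (suc j)) r)
      ≡⟨ ∑-distrib-− (λ r → B i r ℤ.* Iᴹ r j) (λ r → B i r ℤ.* 𝐞 (f (suc j)) r) ⟩
    ∑ (λ r → B i r ℤ.* Iᴹ r j) ℤ.- ∑ (λ r → B i r ℤ.* 𝐞 (f (suc j)) r)
      ≡⟨ cong₂ ℤ._-_ (∑-𝐞 (B i) (suc j)) (∑-𝐞 (B i) (f (suc j))) ⟩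
    B i j ℤ.- extend (B i) (f (suc j)) ∎
    where
    distrib : ∀ a b c → a ℤ.* (b ℤ.- c) ≡ a ℤ.* b ℤ.- a ℤ.* c
    distrib = solve-∀

  neumann-⊗-I⊖M : neumann ⊗ I⊖M ≈ Iᴹ
  neumann-⊗-I⊖M i j = begin
    (neumann ⊗ I⊖M) i j
      ≡⟨ ⊗-I⊖M neumann i j ⟩
    neumann i j ℤ.- extend (neumann i) (f (suc j))
      ≡⟨ cong₂ ℤ._-_ (neumann-entry i j) (extend-neumann i (f (suc j))) ⟩
    orbitSum n (suc j) i ℤ.- orbitSum n (f (suc j)) i
      -- The orbit of `f (suc j)` is that of `suc j` shifted by one step, so the difference of the
      -- two sums telescopes.
      ≡⟨ ∑-distrib-− {n} (λ k → 𝐞 (iterate f (suc j) (toℕ k)) i) (λ k → 𝐞 (iterate f (f (suc j)) (toℕ k)) i) ⟨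
    ∑ {n} (λ k → 𝐞 (iterate f (suc j) (toℕ k)) i ℤ.- 𝐞 (iterate f (suc j) (suc (toℕ k))) i)
      ≡⟨ orbitSum-telescope i (suc j) ⟩
    Iᴹ i j ∎

  extend-I⊖M : ∀ i x → extend (I⊖M i) x ≡ 𝐞 x i ℤ.- 𝐞 (f x) i
  extend-I⊖M i zero    = cong (λ x → 0ℤ ℤ.- 𝐞 x i) (sym f0≡0)
  extend-I⊖M i (suc j) = refl

  I⊖M-⊗-neumann : I⊖M ⊗ neumann ≈ Iᴹ
  I⊖M-⊗-neumann i j = begin
    ∑ (λ r → I⊖M i r ℤ.* neumann r j)
      ≡⟨ sum-cong-≗ (λ r → trans (cong (I⊖M i r ℤ.*_) (neumann-entry r j))
                                 (*-distribˡ-sum {n} (I⊖M i r) (λ k → 𝐞 (orbit k) r))) ⟩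
    ∑ (λ r → ∑ {n} (λ k → I⊖M i r ℤ.* 𝐞 (orbit k) r))
      -- With the sum over `k` outermost, I - M acts on one unit vector of the orbit at a time and
      -- yields consecutive differences.
      ≡⟨ ∑-comm (λ r k → I⊖M i r ℤ.* 𝐞 (orbit k) r) ⟩
    ∑ {n} (λ k → ∑ (λ r → I⊖M i r ℤ.* 𝐞 (orbit k) r))
      ≡⟨ sum-cong-≗ {n} (λ k → trans (∑-𝐞 (I⊖M i) (orbit k)) (trans (extend-I⊖M i (orbit k))
           (cong (λ x → 𝐞 (orbit k) i ℤ.- 𝐞 x i) (sym (iterate-suc f (suc j) (toℕ k)))))) ⟩
    ∑ {n} (λ k → 𝐞 (orbit k) i ℤ.- 𝐞 (iterate f (suc j) (suc (toℕ k))) i)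
      ≡⟨ orbitSum-telescope i (suc j) ⟩
    Iᴹ i j ∎
    where
    orbit : Fin n → Fin (suc n)
    orbit k = iterate f (suc j) (toℕ k)

  -- Transfers the assertions about an arbitrary inverse to the Neumann series. The remainder after
  -- `n` unfoldings is the extended row at 0, which is 0.
  left-inverse-unique : ∀ B → B ⊗ I⊖M ≈ Iᴹ → B ≈ neumann
  left-inverse-unique B BA≈I i j = begin
    B i j
      ≡⟨ unfold n (suc j) ⟩
    orbitSum n (suc j) i ℤ.+ extend (B i) (iterate f (suc j) n)
      ≡⟨ cong (λ x → orbitSum n (suc j) i ℤ.+ extend (B i) x) (iterate-n≡0 (suc j)) ⟩
    orbitSum n (suc j) i ℤ.+ 0ℤ
      ≡⟨ ℤₚ.+-identityʳ _ ⟩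
    orbitSum n (suc j) i
      ≡⟨ neumann-entry i j ⟨
    neumann i j ∎
    where
    difference : ∀ a b c → a ℤ.- b ≡ c → a ≡ c ℤ.+ b
    difference a b _ refl = add-back a b
      where
      add-back : ∀ a b → a ≡ (a ℤ.- b) ℤ.+ b
      add-back = solve-∀

    step : ∀ x → extend (B i) x ≡ 𝐞 x i ℤ.+ extend (B i) (f x)
    step zero    = cong (λ x → 0ℤ ℤ.+ extend (B i) x) (sym f0≡0)
    step (suc s) = difference _ _ _ (trans (sym (⊗-I⊖M B i s)) (BA≈I i s))

    unfold : ∀ m x → extend (B i) x ≡ orbitSum m x i ℤ.+ extend (B i) (iterate f x m)
    unfold zero    x = sym (ℤₚ.+-identityˡ _)
    unfold (suc m) x = begin
      extend (B i) x
        ≡⟨ step x ⟩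
      𝐞 x i ℤ.+ extend (B i) (f x)
        ≡⟨ cong (ℤ._+_ (𝐞 x i)) (unfold m (f x)) ⟩
      𝐞 x i ℤ.+ (orbitSum m (f x) i ℤ.+ extend (B i) (iterate f x (suc m)))
        ≡⟨ ℤₚ.+-assoc (𝐞 x i) _ _ ⟨
      orbitSum (suc m) x i ℤ.+ extend (B i) (iterate f x (suc m)) ∎

  -- Entries of the inverse and their number.

  neumann-binary : Binary neumann
  neumann-binary i j = ∑-binary {n} _ (λ k → power-binary (toℕ k) i j)
    -- The supports of distinct powers are disjoint, so at most one summand is nonzero at each
    -- position.
    λ k l k≢0 l≢0 → Finₚ.toℕ-injective (powers-disjoint (toℕ k) (toℕ l) i j k≢0 l≢0)

  module _ {B : Matrix n} (B≈neumann : B ≈ neumann) where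

    inverse-binary : Binary B
    inverse-binary i j = subst (λ z → z ≡ 0ℤ ⊎ z ≡ 1ℤ) (sym (B≈neumann i j)) (neumann-binary i j)

    #-inverse : # B ≡ sum {n} (λ k → # (matrixOf f ^ᴹ toℕ k))
    #-inverse = ℤₚ.+-injective (begin
      + # B
        ≡⟨ #-binary inverse-binary ⟩
      ∑ (λ i → ∑ (λ j → B i j))
        ≡⟨ sum-cong-≗ (λ i → trans (sum-cong-≗ (B≈neumann i)) (∑-comm {n} {n} (λ j k → (matrixOf f ^ᴹ toℕ k) i j))) ⟩
      ∑ (λ i → ∑ {n} (λ k → ∑ (λ j → (matrixOf f ^ᴹ toℕ k) i j)))
        ≡⟨ ∑-comm {n} {n} (λ i k → ∑ (λ j → (matrixOf f ^ᴹ toℕ k) i j)) ⟩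
      ∑ {n} (λ k → ∑ (λ i → ∑ (λ j → (matrixOf f ^ᴹ toℕ k) i j)))
        ≡⟨ sum-cong-≗ {n} (λ k → sym (#-binary (power-binary (toℕ k)))) ⟩
      ∑ {n} (λ k → + # (matrixOf f ^ᴹ toℕ k))
        ≡⟨ pos-sum {n} _ ⟨
      + sum {n} (λ k → # (matrixOf f ^ᴹ toℕ k)) ∎)

    #-inverse≤ : # B ≤ suc n C 2
    #-inverse≤ = ℕₚ.≤-trans (ℕₚ.≤-reflexive #-inverse)
      (ℕₚ.≤-trans (sum-mono-≤ {n} _ _ (#-power≤ ∘ toℕ)) (ℕₚ.≤-reflexive (sum-[n∸k]≡[n+1]C2 n)))

-- The local function as an acyclic map.

module _ (φ : ℕ → ℕ) (φ-moves : ∀ x → 1 ≤ x → φ x ≢ x) (n : ℕ) where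

  localFun-moves : ∀ {x} → x ≢ zero → localFun φ n x ≢ x
  localFun-moves {zero}  x≢0 _ = x≢0 refl
  localFun-moves {suc j} _   eq with φ (suc (toℕ j)) ℕₚ.<? suc n
  ... | yes φx≤n = φ-moves (suc (toℕ j)) (s≤s z≤n) (trans (sym (Finₚ.toℕ-fromℕ< φx≤n)) (cong toℕ eq))
  ... | no  _    with () ← eq

  -- `HasCycle` only speaks of periods at least 2; period 1 is excluded by `φ x ≢ x`.
  localFun-acyclic : ¬ HasCycle (localFun φ n) →
                     ∀ m {x} → x ≢ zero → iterate (localFun φ n) x (suc m) ≢ x
  localFun-acyclic _       zero    x≢0 eq = localFun-moves x≢0 eq
  localFun-acyclic noCycle (suc m) {x} x≢0 eq = noCycle (suc (suc m) , x , s≤s (s≤s z≤n) , x≢0 , eq)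

theorem1p5 :
  (φ : ℕ → ℕ) → φ 0 ≡ 0 → (∀ x → 1 ≤ x → φ x ≢ x) →
  (n : ℕ) → 2 ≤ n → ¬ HasCycle (localFun φ n) →
  -- (1)
  (∃[ d ] (d ≤ n × NilpotentOfDegree (M φ n) d)) ×
  -- (2)
  ((∀ k → 1 ≤ k → Binary (M φ n ^ᴹ k)) ×
   (∀ k → 1 ≤ k → k ≤ n → # (M φ n ^ᴹ k) ≤ n ∸ k) ×
   (∀ k l → 1 ≤ k → 1 ≤ l → k ≢ l → (M φ n ^ᴹ k) ∩ (M φ n ^ᴹ l) ≡ 0)) ×
  -- (3)
  (Invertible (M̂ φ n) × det (M̂ φ n) ≡ 1ℤ) ×
  -- (4)
  (∀ M̂⁻¹ → IsInverse (M̂ φ n) M̂⁻¹ →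
    Binary M̂⁻¹ ×
    M̂⁻¹ ≈ ∑ᴹ (λ (k : Fin n) → M φ n ^ᴹ toℕ k) ×
    # M̂⁻¹ ≡ n + sum (λ (k : Fin (n ∸ 1)) → # (M φ n ^ᴹ suc (toℕ k))) ×
    # M̂⁻¹ ≤ (suc n) C 2)
theorem1p5 φ _ φ-moves n@(suc m) 2≤n noCycle =
  -- Here `refl` proves `f zero ≡ zero`, the first clause of `localFun`.
  nilpotent f refl acyclic (s≤s z≤n) ,
  ((λ k _ → power-binary f refl acyclic k) ,
   (λ k _ _ → #-power≤ f refl acyclic k) ,
   (λ k l _ _ → power-∩ f refl acyclic k l)) ,
  ((neumann f refl acyclic , I⊖M-⊗-neumann f refl acyclic , neumann-⊗-I⊖M f refl acyclic) ,
   det-I⊖M f refl acyclic) ,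
  λ B (_ , BA≈I) → let B≈neumann = left-inverse-unique f refl acyclic B BA≈I in
    inverse-binary f refl acyclic B≈neumann ,
    B≈neumann ,
    -- The count sums over exponents from 0; since `n` is `suc m`, the term of the identity splits
    -- off and equals `n`.
    trans (#-inverse f refl acyclic B≈neumann)
          (cong (_+ sum {m} (λ k → # (M φ n ^ᴹ suc (toℕ k)))) (trans (#-power f refl acyclic 0) (sum-one n))) ,
    #-inverse≤ f refl acyclic B≈neumann
  where
  f = localFun φ n
  acyclic = localFun-acyclic φ φ-moves n noCycle
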